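{- Let $\mathbb{A}$ be a symmetric strict monoidal category and let $\mathbf{H}\,\mathcal{C}(\mathbb{A})$ be the strict monoidal category of horizontal cells of its free cornering. There is a contravariant involution $(-)^*:\mathbf{H}\,\mathcal{C}(\mathbb{A})^{\mathsf{op}}\to\mathbf{H}\,\mathcal{C}(\mathbb{A})$ (a functor with $X^{**}=X$ and $f^{**}=f$ for all objects $X$ and morphisms $f$), given on objects by $I^*=I$, $(A^\circ)^*=A^\bullet$, $(A^\bullet)^*=A^\circ$ and $(X\otimes Y)^*=X^*\otimes Y^*$, with the property that $(f\otimes g)^*=f^*\otimes g^*$ for all morphisms $f,g$.
   Context: Single-object double categories. A single-object double category $\mathbb{D}$ consists of a monoid $(\mathbb{D}_H,\otimes,I)$ of horizontal edges, a monoid $(\mathbb{D}_V,\otimes,I)$ of vertical edges, and cells $\alpha$, each with a top and a bottom boundary in $\mathbb{D}_H$ and a left and a right boundary in $\mathbb{D}_V$. If the right boundary of $\alpha$ equals the left boundary of $\beta$ there is a horizontal composite $\alpha\vert\beta$ (top/bottom boundaries are multiplied in the order $\alpha,\beta$; left boundary that of $\alpha$, right boundary that of $\beta$). If the bottom boundary of $\alpha$ equals the top boundary of $\beta$ there is a vertical composite $\frac{\alpha}{\beta}$ (left/right boundaries multiplied in the order $\alpha,\beta$; top that of $\alpha$, bottom that of $\beta$). Both compositions are associative and unital, with identity cells $1_A$ for $A\in\mathbb{D}_H$ (top $=$ bottom $=A$, left $=$ right $=I$; identities for vertical composition) and $1_X$ for $X\in\mathbb{D}_V$ (left $=$ right $=X$,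 top $=$ bottom $=I$; identities for horizontal composition), with $1_A\vert 1_B=1_{A\otimes B}$, $\frac{1_X}{1_Y}=1_{X\otimes Y}$, the two identity cells on $I$ coincide, and the interchange law $\frac{\alpha}{\beta}\big\vert\frac{\gamma}{\delta}=\frac{\alpha\vert\gamma}{\beta\vert\delta}$ holds. Horizontal cells. $\mathbf{H}\mathbb{D}$ is the strict monoidal category with object set $\mathbb{D}_V$, whose morphisms $X\to Y$ are cells with left boundary $X$, right boundary $Y$ and top and bottom boundary $I$; composition is horizontal composition, and the tensor product is vertical composition, $h\otimes k=\frac{h}{k}$. Free cornering. For a symmetric strict monoidal category $\mathbb{A}$ (with object set $\mathbb{A}_0$), $\mathcal{C}(\mathbb{A})$ is the free single-object double category determined by: horizontal edge monoid $(\mathbb{A}_0,\otimes,I)$; vertical edge monoid the free monoid $\mathbb{A}^{\circ\bullet}=(\mathbb{A}_0\times\{\circ,\bullet\})^*$, with generators written $A^\circ$, $A^\bullet$, product written $\otimes$ and unit $I$; generating cells, for each $A\in\mathbb{A}_0$, the corners (boundaries not mentioned are $I$) - $s^\circ_A$: top $A$, right $A^\circ$; $\quad r^\circ_A$: left $A^\circ$, bottom $A$; - $s^\bullet_A$: top $A$, left $A^\bullet$; $\quad r^\bullet_A$: right $A^\bullet$, bottom $A$; and, for each morphism $f:A\to B$ of $\mathbb{A}$, a cell $\ulcorner f\urcorner$ with top $A$, bottom $B$; subject to the yanking equations $s^\circ_A\vert r^\circ_A=1_A$, $\frac{r^\circ_A}{s^\circ_A}=1_{A^\circ}$, $r^\bullet_A\vert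 s^\bullet_A=1_A$, $\frac{r^\bullet_A}{s^\bullet_A}=1_{A^\bullet}$, and the equations $\frac{\ulcorner f\urcorner}{\ulcorner g\urcorner}=\ulcorner f;g\urcorner$ (for composable $f,g$; $f;g$ is "first $f$ then $g$"), $\ulcorner 1_A\urcorner=1_A$, $\ulcorner f\urcorner\vert\ulcorner g\urcorner=\ulcorner f\otimes g\urcorner$. -}

module Defs where

open import Algebra.Structures using (IsMonoid)
open import Data.List.Base using (List; []; [_]; _++_)
open import Data.List.Properties using (++-isMonoid)
open import Data.Product.Base using (_×_; _,_)
open import Level using (Level; _⊔_; suc)
open import Relation.Binary.Core using (Rel)
open import Relation.Binary.Structures using (IsEquivalence)
open import Relation.Binary.PropositionalEquality.Core using (_≡_; refl)

-- Objects and edges are compared with _≡_, arrows and cells with a setoid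
-- equality.  Laws such as f ⊗ (g ⊗ h) = (f ⊗ g) ⊗ h compare arrows whose
-- endpoints are only propositionally equal; they are stated with Het (for cells,
-- Het□): "equal boundaries, and equal as arrows".

data Het {o ℓ e : Level} {O : Set o} (Hom : O → O → Set ℓ)
         (_≈_ : ∀ {A B} → Rel (Hom A B) e)
         {A B : O} (f : Hom A B) : {C D : O} → Hom C D → Set (ℓ ⊔ e) where
  het : {g : Hom A B} → f ≈ g → Het Hom _≈_ f g

data Het□ {h v c e : Level} {H : Set h} {V : Set v}
          (Cell : H → H → V → V → Set c)
          (_≈_ : ∀ {A B X Y} → Rel (Cell A B X Y) e)
          {A B : H} {X Y : V} (α : Cell A B X Y) :
          {A′ B′ : H} {X′ Y′ : V} → Cell A′ B′ X′ Y′ → Set (c ⊔ e) where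
  het : {β : Cell A B X Y} → α ≈ β → Het□ Cell _≈_ α β

------------------------------------------------------------------------
-- Categories

-- _⨾_ is in diagrammatic order: f ⨾ g is "first f, then g".
record Category (o ℓ e : Level) : Set (suc (o ⊔ ℓ ⊔ e)) where
  infix  4 _≈_ _≋_
  infixr 7 _⨾_
  field
    Obj       : Set o
    Hom       : Obj → Obj → Set ℓ
    _≈_       : ∀ {A B} → Rel (Hom A B) e
    ≈-equiv   : ∀ {A B} → IsEquivalence (_≈_ {A} {B})
    id        : ∀ {A} → Hom A A
    _⨾_       : ∀ {A B C} → Hom A B → Hom B C → Hom A C
    ⨾-cong    : ∀ {A B C} {f f′ : Hom A B} {g g′ : Hom B C} →
                f ≈ f′ → g ≈ g′ → f ⨾ g ≈ f′ ⨾ g′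
    identityˡ : ∀ {A B} (f : Hom A B) → id ⨾ f ≈ f
    identityʳ : ∀ {A B} (f : Hom A B) → f ⨾ id ≈ f
    assoc     : ∀ {A B C D} (f : Hom A B) (g : Hom B C) (h : Hom C D) →
                (f ⨾ g) ⨾ h ≈ f ⨾ (g ⨾ h)

  _≋_ : ∀ {A B C D} → Hom A B → Hom C D → Set (ℓ ⊔ e)
  f ≋ g = Het Hom _≈_ f g

  coe : ∀ {A B} → A ≡ B → Hom A B
  coe refl = id

op : ∀ {o ℓ e} → Category o ℓ e → Category o ℓ e
op C = record
  { Obj       = Obj
  ; Hom       = λ A B → Hom B A
  ; _≈_       = _≈_
  ; ≈-equiv   = ≈-equiv
  ; id        = id
  ; _⨾_       = λ f g → g ⨾ f
  ; ⨾-cong    = λ p q → ⨾-cong q p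
  ; identityˡ = identityʳ
  ; identityʳ = identityˡ
  ; assoc     = λ f g h → IsEquivalence.sym ≈-equiv (assoc h g f)
  }
  where open Category C

record Functor {o ℓ e o′ ℓ′ e′ : Level}
               (C : Category o ℓ e) (D : Category o′ ℓ′ e′) :
               Set (o ⊔ ℓ ⊔ e ⊔ o′ ⊔ ℓ′ ⊔ e′) where
  private
    module C = Category C
    module D = Category D
  field
    F₀       : C.Obj → D.Obj
    F₁       : ∀ {A B} → C.Hom A B → D.Hom (F₀ A) (F₀ B)
    F-cong   : ∀ {A B} {f g : C.Hom A B} → f C.≈ g → F₁ f D.≈ F₁ g
    identity : ∀ {A} → F₁ (C.id {A}) D.≈ D.id
    homo     : ∀ {A B E} (f : C.Hom A B) (g : C.Hom B E) →
               F₁ (f C.⨾ g) D.≈ F₁ f D.⨾ F₁ g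

record ContravariantInvolution {o ℓ e : Level} (C : Category o ℓ e) :
                               Set (o ⊔ ℓ ⊔ e) where
  open Category C
  infix 20 _*₀ _*₁
  field
    functor : Functor (op C) C

  _*₀ : Obj → Obj
  _*₀ = Functor.F₀ functor

  _*₁ : ∀ {X Y} → Hom X Y → Hom (Y *₀) (X *₀)
  _*₁ = Functor.F₁ functor

  field
    involutive₀ : ∀ X → (X *₀) *₀ ≡ X
    involutive₁ : ∀ {X Y} (f : Hom X Y) → (f *₁) *₁ ≋ f

------------------------------------------------------------------------
-- Strict monoidal categories

record StrictMonoidalCategory (o ℓ e : Level) : Set (suc (o ⊔ ℓ ⊔ e)) where
  infixr 8 _⊗_ _⊗₁_
  field
    category : Category o ℓ e
  open Category category public
  field
    _⊗_          : Obj → Obj → Obj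
    I            : Obj
    ⊗-isMonoid   : IsMonoid _≡_ _⊗_ I
    _⊗₁_         : ∀ {A B C D} → Hom A B → Hom C D → Hom (A ⊗ C) (B ⊗ D)
    ⊗₁-cong      : ∀ {A B C D} {f f′ : Hom A B} {g g′ : Hom C D} →
                   f ≈ f′ → g ≈ g′ → f ⊗₁ g ≈ f′ ⊗₁ g′
    ⊗₁-id        : ∀ {A B} → id {A} ⊗₁ id {B} ≈ id
    ⊗₁-⨾         : ∀ {A B C A′ B′ C′}
                   (f : Hom A B) (g : Hom B C) (f′ : Hom A′ B′) (g′ : Hom B′ C′) →
                   (f ⨾ g) ⊗₁ (f′ ⨾ g′) ≈ (f ⊗₁ f′) ⨾ (g ⊗₁ g′)
    ⊗₁-assoc     : ∀ {A B C A′ B′ C′}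
                   (f : Hom A A′) (g : Hom B B′) (h : Hom C C′) →
                   (f ⊗₁ g) ⊗₁ h ≋ f ⊗₁ (g ⊗₁ h)
    ⊗₁-identityˡ : ∀ {A B} (f : Hom A B) → id {I} ⊗₁ f ≋ f
    ⊗₁-identityʳ : ∀ {A B} (f : Hom A B) → f ⊗₁ id {I} ≋ f

record SymmetricStrictMonoidalCategory (o ℓ e : Level) :
                                       Set (suc (o ⊔ ℓ ⊔ e)) where
  field
    strictMonoidal : StrictMonoidalCategory o ℓ e
  open StrictMonoidalCategory strictMonoidal public
  open IsMonoid ⊗-isMonoid using () renaming (assoc to ⊗-assoc)
  field
    σ            : ∀ A B → Hom (A ⊗ B) (B ⊗ A)
    σ-natural    : ∀ {A B C D} (f : Hom A B) (g : Hom C D) →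
                   (f ⊗₁ g) ⨾ σ B D ≈ σ A C ⨾ (g ⊗₁ f)
    σ-involutive : ∀ A B → σ A B ⨾ σ B A ≈ id
    σ-hexagon    : ∀ A B C →
                   (σ A B ⊗₁ id {C}) ⨾ coe (⊗-assoc B A C) ⨾ (id {B} ⊗₁ σ A C)
                   ≋ σ A (B ⊗ C)

------------------------------------------------------------------------
-- Single-object double categories

-- Cell A B X Y has top A, bottom B, left X and right Y.  The horizontal
-- composite is α ∣ β; the vertical composite, α above β, is α ÷ β.
record SingleObjectDoubleCategory (h v c e : Level) :
                                  Set (suc (h ⊔ v ⊔ c ⊔ e)) where
  infix  4 _≈_ _≋_
  infixr 6 _∣_
  infixr 7 _÷_
  infixr 8 _⊗ʰ_ _⊗ᵛ_
  field
    Hor         : Set h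
    _⊗ʰ_        : Hor → Hor → Hor
    Iʰ          : Hor
    ⊗ʰ-isMonoid : IsMonoid _≡_ _⊗ʰ_ Iʰ

    Ver         : Set v
    _⊗ᵛ_        : Ver → Ver → Ver
    Iᵛ          : Ver
    ⊗ᵛ-isMonoid : IsMonoid _≡_ _⊗ᵛ_ Iᵛ

    Cell        : (top bottom : Hor) (left right : Ver) → Set c
    _≈_         : ∀ {A B X Y} → Rel (Cell A B X Y) e
    ≈-equiv     : ∀ {A B X Y} → IsEquivalence (_≈_ {A} {B} {X} {Y})

    _∣_ : ∀ {A B A′ B′ X Y Z} →
          Cell A B X Y → Cell A′ B′ Y Z → Cell (A ⊗ʰ A′) (B ⊗ʰ B′) X Z
    _÷_ : ∀ {A B C X X′ Y Y′} →
          Cell A B X Y → Cell B C X′ Y′ → Cell A C (X ⊗ᵛ X′) (Y ⊗ᵛ Y′)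
    1ʰ  : ∀ A → Cell A A Iᵛ Iᵛ
    1ᵛ  : ∀ X → Cell Iʰ Iʰ X X

  _≋_ : ∀ {A B X Y A′ B′ X′ Y′} → Cell A B X Y → Cell A′ B′ X′ Y′ → Set (c ⊔ e)
  α ≋ β = Het□ Cell _≈_ α β

  field
    ∣-cong      : ∀ {A B A′ B′ X Y Z} {α α′ : Cell A B X Y} {β β′ : Cell A′ B′ Y Z} →
                  α ≈ α′ → β ≈ β′ → α ∣ β ≈ α′ ∣ β′
    ÷-cong      : ∀ {A B C X X′ Y Y′} {α α′ : Cell A B X Y} {β β′ : Cell B C X′ Y′} →
                  α ≈ α′ → β ≈ β′ → α ÷ β ≈ α′ ÷ β′
    ∣-assoc     : ∀ {A B A′ B′ A″ B″ X Y Z W}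
                  (α : Cell A B X Y) (β : Cell A′ B′ Y Z) (γ : Cell A″ B″ Z W) →
                  (α ∣ β) ∣ γ ≋ α ∣ (β ∣ γ)
    ÷-assoc     : ∀ {A B C D X Y X′ Y′ X″ Y″}
                  (α : Cell A B X Y) (β : Cell B C X′ Y′) (γ : Cell C D X″ Y″) →
                  (α ÷ β) ÷ γ ≋ α ÷ (β ÷ γ)
    ∣-identityˡ : ∀ {A B X Y} (α : Cell A B X Y) → 1ᵛ X ∣ α ≋ α
    ∣-identityʳ : ∀ {A B X Y} (α : Cell A B X Y) → α ∣ 1ᵛ Y ≋ α
    ÷-identityˡ : ∀ {A B X Y} (α : Cell A B X Y) → 1ʰ A ÷ α ≋ α
    ÷-identityʳ : ∀ {A B X Y} (α : Cell A B X Y) → α ÷ 1ʰ B ≋ α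
    1ʰ-∣        : ∀ A B → 1ʰ A ∣ 1ʰ B ≈ 1ʰ (A ⊗ʰ B)
    1ᵛ-÷        : ∀ X Y → 1ᵛ X ÷ 1ᵛ Y ≈ 1ᵛ (X ⊗ᵛ Y)
    1ʰ≈1ᵛ       : 1ʰ Iʰ ≈ 1ᵛ Iᵛ
    interchange : ∀ {A B C A′ B′ C′ X Y Z X′ Y′ Z′}
                  (α : Cell A B X Y) (β : Cell B C X′ Y′)
                  (γ : Cell A′ B′ Y Z) (δ : Cell B′ C′ Y′ Z′) →
                  (α ÷ β) ∣ (γ ÷ δ) ≈ (α ∣ γ) ÷ (β ∣ δ)

-- The composite of two cells with top and bottom I has top and bottom I ⊗ I;
-- cast transports it back along I ⊗ I ≡ I.
module _ {h v c e} (𝔻 : SingleObjectDoubleCategory h v c e) where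
  open SingleObjectDoubleCategory 𝔻
  open IsMonoid ⊗ʰ-isMonoid using () renaming (identityˡ to ⊗ʰ-identityˡ)

  private
    module Eq {A B X Y} = IsEquivalence (≈-equiv {A} {B} {X} {Y})

    cast : ∀ {A B X Y} → A ≡ B → Cell A A X Y → Cell B B X Y
    cast refl α = α

    cast-cong : ∀ {A B X Y} (p : A ≡ B) {α β : Cell A A X Y} →
                α ≈ β → cast p α ≈ cast p β
    cast-cong refl q = q

    cast-≋ : ∀ {A B X Y} (p : A ≡ B) (α : Cell A A X Y) → cast p α ≋ α
    cast-≋ refl α = het Eq.refl

    cast-÷ : ∀ {A B X Y X′ Y′} (p : A ≡ B) (α : Cell A A X Y) (β : Cell A A X′ Y′) →
             cast p (α ÷ β) ≈ cast p α ÷ cast p β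
    cast-÷ refl α β = Eq.refl

    ≋-sym : ∀ {A B X Y A′ B′ X′ Y′} {α : Cell A B X Y} {β : Cell A′ B′ X′ Y′} →
            α ≋ β → β ≋ α
    ≋-sym (het p) = het (Eq.sym p)

    ≋-trans : ∀ {A B X Y A′ B′ X′ Y′ A″ B″ X″ Y″}
              {α : Cell A B X Y} {β : Cell A′ B′ X′ Y′} {γ : Cell A″ B″ X″ Y″} →
              α ≋ β → β ≋ γ → α ≋ γ
    ≋-trans (het p) (het q) = het (Eq.trans p q)

    ≋⇒≈ : ∀ {A B X Y} {α β : Cell A B X Y} → α ≋ β → α ≈ β
    ≋⇒≈ (het p) = p

    ∣-cong-≋ : ∀ {A B A′ B′ C D C′ D′ X Y Z}
               {α : Cell A B X Y} {α′ : Cell C D X Y}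
               {β : Cell A′ B′ Y Z} {β′ : Cell C′ D′ Y Z} →
               α ≋ α′ → β ≋ β′ → α ∣ β ≋ α′ ∣ β′
    ∣-cong-≋ (het p) (het q) = het (∣-cong p q)

    hom : ∀ {X Y X′ Y′} {α : Cell Iʰ Iʰ X Y} {β : Cell Iʰ Iʰ X′ Y′} → α ≋ β →
          Het (Cell Iʰ Iʰ) _≈_ α β
    hom (het p) = het p

    II : Iʰ ⊗ʰ Iʰ ≡ Iʰ
    II = ⊗ʰ-identityˡ Iʰ

    infixr 6 _⨾_
    _⨾_ : ∀ {X Y Z} → Cell Iʰ Iʰ X Y → Cell Iʰ Iʰ Y Z → Cell Iʰ Iʰ X Z
    α ⨾ β = cast II (α ∣ β)

    1ᵛ≋1ʰ : 1ᵛ Iᵛ ≋ 1ʰ Iʰ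
    1ᵛ≋1ʰ = het (Eq.sym 1ʰ≈1ᵛ)

    horizontalCategory : Category v c e
    horizontalCategory = record
      { Obj       = Ver
      ; Hom       = Cell Iʰ Iʰ
      ; _≈_       = _≈_
      ; ≈-equiv   = ≈-equiv
      ; id        = 1ᵛ _
      ; _⨾_       = _⨾_
      ; ⨾-cong    = λ p q → cast-cong II (∣-cong p q)
      ; identityˡ = λ α → ≋⇒≈ (≋-trans (cast-≋ II _) (∣-identityˡ α))
      ; identityʳ = λ α → ≋⇒≈ (≋-trans (cast-≋ II _) (∣-identityʳ α))
      ; assoc     = λ α β γ → ≋⇒≈
          (≋-trans (cast-≋ II _)
          (≋-trans (∣-cong-≋ (cast-≋ II _) (het Eq.refl))
          (≋-trans (∣-assoc α β γ)
          (≋-sym (≋-trans (cast-≋ II _)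
                          (∣-cong-≋ (het Eq.refl) (cast-≋ II _)))))))
      }

  𝐇 : StrictMonoidalCategory v c e
  𝐇 = record
    { category     = horizontalCategory
    ; _⊗_          = _⊗ᵛ_
    ; I            = Iᵛ
    ; ⊗-isMonoid   = ⊗ᵛ-isMonoid
    ; _⊗₁_         = _÷_
    ; ⊗₁-cong      = ÷-cong
    ; ⊗₁-id        = 1ᵛ-÷ _ _
    ; ⊗₁-⨾         = λ α β α′ β′ →
        Eq.trans (Eq.sym (cast-÷ II (α ∣ β) (α′ ∣ β′)))
                 (cast-cong II (Eq.sym (interchange α α′ β β′)))
    ; ⊗₁-assoc     = λ α β γ → hom (÷-assoc α β γ)
    ; ⊗₁-identityˡ = λ α → hom (≋-trans (het (÷-cong (Eq.sym 1ʰ≈1ᵛ) Eq.refl))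
                                        (÷-identityˡ α))
    ; ⊗₁-identityʳ = λ α → hom (≋-trans (het (÷-cong Eq.refl (Eq.sym 1ʰ≈1ᵛ)))
                                        (÷-identityʳ α))
    }

------------------------------------------------------------------------
-- The free cornering

data Polarity : Set where
  ○ ● : Polarity

infix 20 _° _•
_° _• : ∀ {o} {O : Set o} → O → List (O × Polarity)
A ° = [ A , ○ ]
A • = [ A , ● ]

module FreeCornering {o ℓ e} (𝔸 : SymmetricStrictMonoidalCategory o ℓ e) where
  open SymmetricStrictMonoidalCategory 𝔸
    using (Obj; Hom; id; I; ⊗-isMonoid; _⊗₁_)
    renaming (_≈_ to _≈ᴬ_; _⨾_ to _⨾ᴬ_; _⊗_ to _⊗ᴬ_)

  private
    Edge : Set o
    Edge = List (Obj × Polarity)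

  infixr 6 _∣_
  infixr 7 _÷_

  data Cell : (top bottom : Obj) (left right : Edge) → Set (o ⊔ ℓ) where
    s° : ∀ A → Cell A I []    (A °)
    r° : ∀ A → Cell I A (A °) []
    s• : ∀ A → Cell A I (A •) []
    r• : ∀ A → Cell I A []    (A •)
    ⌜_⌝ : ∀ {A B} → Hom A B → Cell A B [] []
    1ʰ : ∀ A → Cell A A [] []
    1ᵛ : ∀ X → Cell I I X X
    _∣_ : ∀ {A B A′ B′ X Y Z} →
          Cell A B X Y → Cell A′ B′ Y Z → Cell (A ⊗ᴬ A′) (B ⊗ᴬ B′) X Z
    _÷_ : ∀ {A B C X X′ Y Y′} →
          Cell A B X Y → Cell B C X′ Y′ → Cell A C (X ++ X′) (Y ++ Y′)

  infix 4 _≋_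

  -- The congruence generated by the axioms of a single-object double category and
  -- the equations of the free cornering.  It relates terms whose boundary
  -- expressions differ, but only when the boundaries are propositionally equal:
  -- this holds for each axiom, and congruence, symmetry and transitivity keep it.
  data _≋_ : ∀ {A B X Y A′ B′ X′ Y′} →
             Cell A B X Y → Cell A′ B′ X′ Y′ → Set (o ⊔ ℓ ⊔ e) where
    ≋-refl  : ∀ {A B X Y} {α : Cell A B X Y} → α ≋ α
    ≋-sym   : ∀ {A B X Y A′ B′ X′ Y′}
              {α : Cell A B X Y} {β : Cell A′ B′ X′ Y′} → α ≋ β → β ≋ α
    ≋-trans : ∀ {A B X Y A′ B′ X′ Y′ A″ B″ X″ Y″}
              {α : Cell A B X Y} {β : Cell A′ B′ X′ Y′} {γ : Cell A″ B″ X″ Y″} →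
              α ≋ β → β ≋ γ → α ≋ γ

    ∣-cong : ∀ {A B X Y C D Z A′ B′ X′ Y′ C′ D′ Z′}
             {α : Cell A B X Y} {β : Cell C D Y Z}
             {α′ : Cell A′ B′ X′ Y′} {β′ : Cell C′ D′ Y′ Z′} →
             α ≋ α′ → β ≋ β′ → α ∣ β ≋ α′ ∣ β′
    ÷-cong : ∀ {A B C X Y Z W A′ B′ C′ X′ Y′ Z′ W′}
             {α : Cell A B X Y} {β : Cell B C Z W}
             {α′ : Cell A′ B′ X′ Y′} {β′ : Cell B′ C′ Z′ W′} →
             α ≋ α′ → β ≋ β′ → α ÷ β ≋ α′ ÷ β′
    ⌜⌝-cong : ∀ {A B} {f g : Hom A B} → f ≈ᴬ g → ⌜ f ⌝ ≋ ⌜ g ⌝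

    ∣-assoc : ∀ {A B A′ B′ A″ B″ X Y Z W}
              (α : Cell A B X Y) (β : Cell A′ B′ Y Z) (γ : Cell A″ B″ Z W) →
              (α ∣ β) ∣ γ ≋ α ∣ (β ∣ γ)
    ÷-assoc : ∀ {A B C D X Y X′ Y′ X″ Y″}
              (α : Cell A B X Y) (β : Cell B C X′ Y′) (γ : Cell C D X″ Y″) →
              (α ÷ β) ÷ γ ≋ α ÷ (β ÷ γ)
    ∣-identityˡ : ∀ {A B X Y} (α : Cell A B X Y) → 1ᵛ X ∣ α ≋ α
    ∣-identityʳ : ∀ {A B X Y} (α : Cell A B X Y) → α ∣ 1ᵛ Y ≋ α
    ÷-identityˡ : ∀ {A B X Y} (α : Cell A B X Y) → 1ʰ A ÷ α ≋ α
    ÷-identityʳ : ∀ {A B X Y} (α : Cell A B X Y) → α ÷ 1ʰ B ≋ α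
    1ʰ-∣ : ∀ A B → 1ʰ A ∣ 1ʰ B ≋ 1ʰ (A ⊗ᴬ B)
    1ᵛ-÷ : ∀ X Y → 1ᵛ X ÷ 1ᵛ Y ≋ 1ᵛ (X ++ Y)
    1ʰ≋1ᵛ : 1ʰ I ≋ 1ᵛ []
    interchange : ∀ {A B C A′ B′ C′ X Y Z X′ Y′ Z′}
                  (α : Cell A B X Y) (β : Cell B C X′ Y′)
                  (γ : Cell A′ B′ Y Z) (δ : Cell B′ C′ Y′ Z′) →
                  (α ÷ β) ∣ (γ ÷ δ) ≋ (α ∣ γ) ÷ (β ∣ δ)

    yank-∣° : ∀ A → s° A ∣ r° A ≋ 1ʰ A
    yank-÷° : ∀ A → r° A ÷ s° A ≋ 1ᵛ (A °)
    yank-∣• : ∀ A → r• A ∣ s• A ≋ 1ʰ A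
    yank-÷• : ∀ A → r• A ÷ s• A ≋ 1ᵛ (A •)

    ⌜⌝-⨾  : ∀ {A B C} (f : Hom A B) (g : Hom B C) → ⌜ f ⌝ ÷ ⌜ g ⌝ ≋ ⌜ f ⨾ᴬ g ⌝
    ⌜⌝-id : ∀ A → ⌜ id {A} ⌝ ≋ 1ʰ A
    ⌜⌝-⊗  : ∀ {A B C D} (f : Hom A B) (g : Hom C D) → ⌜ f ⌝ ∣ ⌜ g ⌝ ≋ ⌜ f ⊗₁ g ⌝

  private
    open IsMonoid ⊗-isMonoid using ()
      renaming (assoc to assocʰ; identityˡ to idˡʰ; identityʳ to idʳʰ)
    open IsMonoid (++-isMonoid {A = Obj × Polarity}) using ()
      renaming (assoc to assocᵛ; identityˡ to idˡᵛ; identityʳ to idʳᵛ)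

    toHet : ∀ {A B X Y A′ B′ X′ Y′} {α : Cell A B X Y} {β : Cell A′ B′ X′ Y′} →
            A ≡ A′ → B ≡ B′ → X ≡ X′ → Y ≡ Y′ →
            α ≋ β → Het□ Cell _≋_ α β
    toHet refl refl refl refl p = het p

  𝒞 : SingleObjectDoubleCategory o o (o ⊔ ℓ) (o ⊔ ℓ ⊔ e)
  𝒞 = record
    { Hor         = Obj
    ; _⊗ʰ_        = _⊗ᴬ_
    ; Iʰ          = I
    ; ⊗ʰ-isMonoid = ⊗-isMonoid
    ; Ver         = Edge
    ; _⊗ᵛ_        = _++_
    ; Iᵛ          = []
    ; ⊗ᵛ-isMonoid = ++-isMonoid
    ; Cell        = Cell
    ; _≈_         = _≋_
    ; ≈-equiv     = record { refl = ≋-refl ; sym = ≋-sym ; trans = ≋-trans }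
    ; _∣_         = _∣_
    ; _÷_         = _÷_
    ; 1ʰ          = 1ʰ
    ; 1ᵛ          = 1ᵛ
    ; ∣-cong      = ∣-cong
    ; ÷-cong      = ÷-cong
    ; ∣-assoc     = λ α β γ →
        toHet (assocʰ _ _ _) (assocʰ _ _ _) refl refl (∣-assoc α β γ)
    ; ÷-assoc     = λ {_} {_} {_} {_} {X} {Y} {X′} {Y′} {X″} {Y″} α β γ →
        toHet refl refl (assocᵛ X X′ X″) (assocᵛ Y Y′ Y″) (÷-assoc α β γ)
    ; ∣-identityˡ = λ α → toHet (idˡʰ _) (idˡʰ _) refl refl (∣-identityˡ α)
    ; ∣-identityʳ = λ α → toHet (idʳʰ _) (idʳʰ _) refl refl (∣-identityʳ α)
    ; ÷-identityˡ = λ α → toHet refl refl (idˡᵛ _) (idˡᵛ _) (÷-identityˡ α)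
    ; ÷-identityʳ = λ α → toHet refl refl (idʳᵛ _) (idʳᵛ _) (÷-identityʳ α)
    ; 1ʰ-∣        = 1ʰ-∣
    ; 1ᵛ-÷        = 1ᵛ-÷
    ; 1ʰ≈1ᵛ       = 1ʰ≋1ᵛ
    ; interchange = interchange
    }

open FreeCornering public using (𝒞)

{-# OPTIONS --safe #-}

-- The involution reflects a cell in a vertical axis, exchanging ○ and ● on its
-- left and right boundaries.  Reflection reverses horizontal composites and hence
-- also their top and bottom boundaries; the symmetry of 𝔸 restores these:
--   (α ∣ β)* = σ ÷ (β* ∣ α*) ÷ σ.
-- The symmetry axioms make this reversed composition ∣ˢ satisfy every law of ∣,
-- and reflection exchanges the yanking equations of A ° with those of A •.
-- On horizontal cells the symmetries are σ I I = id and disappear.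

module Submission where

open import Defs
open import Algebra.Structures using (IsMonoid)
open import Data.List.Base using (List; []; _∷_; _++_; map)
open import Data.List.Properties using (map-++; map-∘; map-id; map-cong; ++-assoc; ++-identityʳ)
open import Data.Product using (Σ-syntax; _×_; _,_; map₂)
open import Relation.Binary.PropositionalEquality
  using (_≡_; refl; sym; trans; cong; cong₂)

flip : Polarity → Polarity
flip ○ = ●
flip ● = ○

flip-involutive : ∀ p → flip (flip p) ≡ p
flip-involutive ○ = refl
flip-involutive ● = refl

module Reflection {o ℓ e} (𝔸 : SymmetricStrictMonoidalCategory o ℓ e) where
  open FreeCornering 𝔸 hiding (𝒞)
  open SymmetricStrictMonoidalCategory 𝔸
    using (Obj; Hom; I; _⊗_; ⊗-isMonoid; coe; id; _⊗₁_;
           σ; σ-natural; σ-involutive; σ-hexagon)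
    renaming (_≋_ to _≋ᴬ_; _⨾_ to _⨾ᴬ_)
  open IsMonoid ⊗-isMonoid using ()
    renaming (assoc to ⊗-assoc; identityˡ to ⊗-identityˡ; identityʳ to ⊗-identityʳ)

  Edge : Set o
  Edge = List (Obj × Polarity)

  private
    variable
      A B C D A′ B′ C′ D′ A″ B″ : Obj
      X Y Z W X′ Y′ Z′ W′ X″ Y″ : Edge

  -- Calculating with cells whose boundaries agree only propositionally.

  infix  1 begin_
  infixr 2 _≋⟨_⟩_ _≋⟨_⟨_
  infix  3 _∎

  begin_ : {α : Cell A B X Y} {β : Cell A′ B′ X′ Y′} → α ≋ β → α ≋ β
  begin p = p

  _≋⟨_⟩_ : (α : Cell A B X Y) {β : Cell A′ B′ X′ Y′} {γ : Cell A″ B″ X″ Y″} →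
           α ≋ β → β ≋ γ → α ≋ γ
  _ ≋⟨ p ⟩ q = ≋-trans p q

  _≋⟨_⟨_ : (α : Cell A B X Y) {β : Cell A′ B′ X′ Y′} {γ : Cell A″ B″ X″ Y″} →
           β ≋ α → β ≋ γ → α ≋ γ
  _ ≋⟨ p ⟨ q = ≋-trans (≋-sym p) q

  _∎ : (α : Cell A B X Y) → α ≋ α
  _ ∎ = ≋-refl

  -- Induction on derivations: each axiom relates boundaries equal by the monoid laws, and the
  -- closure rules preserve this. The equalities extracted here drive `≋⇒Het` and re-index the
  -- symmetries in later congruence arguments.
  boundary : {α : Cell A B X Y} {β : Cell A′ B′ X′ Y′} →
             α ≋ β → A ≡ A′ × B ≡ B′ × X ≡ X′ × Y ≡ Y′
  boundary ≋-refl = refl , refl , refl , refl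
  boundary (≋-sym p) =
    let a , b , x , y = boundary p
    in  sym a , sym b , sym x , sym y
  boundary (≋-trans p q) =
    let a , b , x , y = boundary p
        c , d , z , w = boundary q
    in  trans a c , trans b d , trans x z , trans y w
  boundary (∣-cong p q) =
    let a , b , x , _ = boundary p
        c , d , _ , w = boundary q
    in  cong₂ _⊗_ a c , cong₂ _⊗_ b d , x , w
  boundary (÷-cong p q) =
    let a , _ , x , y = boundary p
        _ , d , z , w = boundary q
    in  a , d , cong₂ _++_ x z , cong₂ _++_ y w
  boundary (⌜⌝-cong _) = refl , refl , refl , refl
  boundary (∣-assoc _ _ _) = ⊗-assoc _ _ _ , ⊗-assoc _ _ _ , refl , refl
  boundary (÷-assoc {X = X} {Y = Y} _ _ _) = refl , refl , ++-assoc X _ _ , ++-assoc Y _ _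
  boundary (∣-identityˡ _) = ⊗-identityˡ _ , ⊗-identityˡ _ , refl , refl
  boundary (∣-identityʳ _) = ⊗-identityʳ _ , ⊗-identityʳ _ , refl , refl
  boundary (÷-identityˡ _) = refl , refl , refl , refl
  boundary (÷-identityʳ _) = refl , refl , ++-identityʳ _ , ++-identityʳ _
  boundary (1ʰ-∣ _ _) = refl , refl , refl , refl
  boundary (1ᵛ-÷ _ _) = refl , refl , refl , refl
  boundary 1ʰ≋1ᵛ = refl , refl , refl , refl
  boundary (interchange _ _ _ _) = refl , refl , refl , refl
  boundary (yank-∣° _) = ⊗-identityʳ _ , ⊗-identityˡ _ , refl , refl
  boundary (yank-÷° _) = refl , refl , refl , refl
  boundary (yank-∣• _) = ⊗-identityˡ _ , ⊗-identityʳ _ , refl , refl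
  boundary (yank-÷• _) = refl , refl , refl , refl
  boundary (⌜⌝-⨾ _ _) = refl , refl , refl , refl
  boundary (⌜⌝-id _) = refl , refl , refl , refl
  boundary (⌜⌝-⊗ _ _) = refl , refl , refl , refl

  ≋⇒Het : {α : Cell A B X Y} {β : Cell A B X′ Y′} → α ≋ β → Het (Cell A B) _≋_ α β
  ≋⇒Het p with _ , _ , x , y ← boundary p = go x y p
    where
    go : {α : Cell A B X Y} {β : Cell A B X′ Y′} →
         X ≡ X′ → Y ≡ Y′ → α ≋ β → Het (Cell A B) _≋_ α β
    go refl refl p = het p

  castᵛ : X ≡ X′ → Y ≡ Y′ → Cell A B X Y → Cell A B X′ Y′
  castᵛ refl refl α = α

  castᵛ-≋ : (p : X ≡ X′) (q : Y ≡ Y′) (α : Cell A B X Y) → castᵛ p q α ≋ α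
  castᵛ-≋ refl refl α = ≋-refl

  1ʰ-cong : A ≡ B → 1ʰ A ≋ 1ʰ B
  1ʰ-cong refl = ≋-refl

  1ᵛ-cong : X ≡ Y → 1ᵛ X ≋ 1ᵛ Y
  1ᵛ-cong refl = ≋-refl

  ⌜⌝-cong-≋ : {f : Hom A B} {g : Hom C D} → f ≋ᴬ g → ⌜ f ⌝ ≋ ⌜ g ⌝
  ⌜⌝-cong-≋ (het p) = ⌜⌝-cong p

  1ʰ-∣-identityˡ : (α : Cell A B [] Y) → 1ʰ I ∣ α ≋ α
  1ʰ-∣-identityˡ α = ≋-trans (∣-cong 1ʰ≋1ᵛ ≋-refl) (∣-identityˡ α)

  1ʰ-∣-identityʳ : (α : Cell A B X []) → α ∣ 1ʰ I ≋ α
  1ʰ-∣-identityʳ α = ≋-trans (∣-cong ≋-refl 1ʰ≋1ᵛ) (∣-identityʳ α)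

  -- Vertical composition along an equality of horizontal edges.

  infixr 7 _÷[_]_

  -- Stacked symmetries often meet in edges that agree only up to associativity or units of `⊗`.
  -- Carrying the equality in the composite avoids interposing a cell `⌜ coe p ⌝`.
  _÷[_]_ : Cell A B X Y → B ≡ B′ → Cell B′ C X′ Y′ → Cell A C (X ++ X′) (Y ++ Y′)
  α ÷[ refl ] β = α ÷ β

  -- The two equality proofs are independent, so either may be `refl`: this is how a calculation
  -- passes between `÷` and `÷[ p ]`.
  ÷[]-cong : {α : Cell A B X Y} {p : B ≡ C} {β : Cell C D Z W}
             {α′ : Cell A′ B′ X′ Y′} {p′ : B′ ≡ C′} {β′ : Cell C′ D′ Z′ W′} →
             α ≋ α′ → β ≋ β′ → α ÷[ p ] β ≋ α′ ÷[ p′ ] β′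
  ÷[]-cong {p = refl} {p′ = refl} q r = ÷-cong q r

  ÷[]-assoc : (α : Cell A B X Y) (p : B ≡ B′) (β : Cell B′ C X′ Y′)
              (q : C ≡ C′) (γ : Cell C′ D X″ Y″) →
              (α ÷[ p ] β) ÷[ q ] γ ≋ α ÷[ p ] (β ÷[ q ] γ)
  ÷[]-assoc α refl β refl γ = ÷-assoc α β γ

  ÷[]-identityˡ : (p : A ≡ B) (α : Cell B C X Y) → 1ʰ A ÷[ p ] α ≋ α
  ÷[]-identityˡ refl α = ÷-identityˡ α

  ÷-coe : (α : Cell A B X Y) (p : B ≡ B′) (β : Cell B′ C X′ Y′) →
          α ÷ ⌜ coe p ⌝ ÷ β ≋ α ÷[ p ] β
  ÷-coe α refl β = ÷-cong ≋-refl (≋-trans (÷-cong (⌜⌝-id _) ≋-refl) (÷-identityˡ β))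

  ÷-unitor : (α : Cell A B X Y) → (1ʰ A ÷ α) ÷ 1ʰ B ≋ α
  ÷-unitor α = ≋-trans (÷-identityʳ _) (÷-identityˡ α)

  -- Serves to cancel, or to insert, a pair of mutually inverse symmetries `ε` in the middle of a
  -- stack.
  ÷-identity-middle : {B≡C : B ≡ C} {C≡B : C ≡ B}
                      (α : Cell A B X Y) {ε : Cell C C Z W} (β : Cell B D X′ Y′) →
                      ε ≋ 1ʰ C → α ÷[ B≡C ] (ε ÷[ C≡B ] β) ≋ α ÷ β
  ÷-identity-middle {B≡C = p} {C≡B = q} α β r =
    ÷[]-cong {p = p} {p′ = refl} ≋-refl
      (≋-trans (÷[]-cong {p = q} {p′ = q} r ≋-refl) (÷[]-identityˡ q β))

  -- In the uses below, `γ` is the core of a nested reversed composite and the other four cells are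
  -- built from symmetries; regrouping makes the symmetries on each side of the core adjacent.
  ÷-regroup : (α : Cell A B X Y) (β : Cell B C X′ Y′) (γ : Cell C D Z W)
              (δ : Cell D A′ Z′ W′) (ε : Cell A′ B′ X″ Y″) →
              (α ÷ ((β ÷ γ) ÷ δ)) ÷ ε ≋ ((α ÷ β) ÷ γ) ÷ (δ ÷ ε)
  ÷-regroup α β γ δ ε = begin
    (α ÷ ((β ÷ γ) ÷ δ)) ÷ ε   ≋⟨ ÷-cong (÷-assoc α (β ÷ γ) δ) ≋-refl ⟨
    ((α ÷ (β ÷ γ)) ÷ δ) ÷ ε   ≋⟨ ÷-assoc _ δ ε ⟩
    (α ÷ (β ÷ γ)) ÷ (δ ÷ ε)   ≋⟨ ÷-cong (÷-assoc α β γ) ≋-refl ⟨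
    ((α ÷ β) ÷ γ) ÷ (δ ÷ ε)   ∎

  -- Coherence of the symmetry, expressed by cells.

  S : ∀ A B → Cell (A ⊗ B) (B ⊗ A) [] []
  S A B = ⌜ σ A B ⌝

  S-cong : A ≡ A′ → B ≡ B′ → S A B ≋ S A′ B′
  S-cong refl refl = ≋-refl

  S-involutive : ∀ A B → S A B ÷ S B A ≋ 1ʰ (A ⊗ B)
  S-involutive A B =
    ≋-trans (⌜⌝-⨾ _ _) (≋-trans (⌜⌝-cong (σ-involutive A B)) (⌜⌝-id _))

  S-natural : (f : Hom A B) (g : Hom C D) →
              (⌜ f ⌝ ∣ ⌜ g ⌝) ÷ S B D ≋ S A C ÷ (⌜ g ⌝ ∣ ⌜ f ⌝)
  S-natural {A} {B} {C} {D} f g = begin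
    (⌜ f ⌝ ∣ ⌜ g ⌝) ÷ S B D     ≋⟨ ÷-cong (⌜⌝-⊗ f g) ≋-refl ⟩
    ⌜ f ⊗₁ g ⌝ ÷ S B D          ≋⟨ ⌜⌝-⨾ _ _ ⟩
    ⌜ (f ⊗₁ g) ⨾ᴬ σ B D ⌝       ≋⟨ ⌜⌝-cong (σ-natural f g) ⟩
    ⌜ σ A C ⨾ᴬ (g ⊗₁ f) ⌝       ≋⟨ ⌜⌝-⨾ _ _ ⟨
    S A C ÷ ⌜ g ⊗₁ f ⌝          ≋⟨ ÷-cong ≋-refl (⌜⌝-⊗ g f) ⟨
    S A C ÷ (⌜ g ⌝ ∣ ⌜ f ⌝)     ∎

  S-naturalʳ : ∀ A (g : Hom C D) →
               (1ʰ A ∣ ⌜ g ⌝) ÷ S A D ≋ S A C ÷ (⌜ g ⌝ ∣ 1ʰ A)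
  S-naturalʳ A g =
    ≋-trans (÷-cong (∣-cong (≋-sym (⌜⌝-id A)) ≋-refl) ≋-refl)
    (≋-trans (S-natural id g) (÷-cong ≋-refl (∣-cong ≋-refl (⌜⌝-id A))))

  S-naturalˡ : ∀ C (f : Hom A B) →
               (⌜ f ⌝ ∣ 1ʰ C) ÷ S B C ≋ S A C ÷ (1ʰ C ∣ ⌜ f ⌝)
  S-naturalˡ C f =
    ≋-trans (÷-cong (∣-cong ≋-refl (≋-sym (⌜⌝-id C))) ≋-refl)
    (≋-trans (S-natural f id) (÷-cong ≋-refl (∣-cong (⌜⌝-id C) ≋-refl)))

  S∣1ʰ-involutive : ∀ A B C → (S A B ∣ 1ʰ C) ÷ (S B A ∣ 1ʰ C) ≋ 1ʰ ((A ⊗ B) ⊗ C)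
  S∣1ʰ-involutive A B C =
    ≋-trans (≋-sym (interchange _ _ _ _))
    (≋-trans (∣-cong (S-involutive A B) (÷-identityˡ _)) (1ʰ-∣ _ _))

  1ʰ∣S-involutive : ∀ A B C → (1ʰ A ∣ S B C) ÷ (1ʰ A ∣ S C B) ≋ 1ʰ (A ⊗ (B ⊗ C))
  1ʰ∣S-involutive A B C =
    ≋-trans (≋-sym (interchange _ _ _ _))
    (≋-trans (∣-cong (÷-identityˡ _) (S-involutive B C)) (1ʰ-∣ _ _))

  hexagon : ∀ A B C → (S A B ∣ 1ʰ C) ÷[ ⊗-assoc B A C ] (1ʰ B ∣ S A C) ≋ S A (B ⊗ C)
  hexagon A B C = begin
    (S A B ∣ 1ʰ C) ÷[ p ] (1ʰ B ∣ S A C)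
      ≋⟨ ÷-coe _ p _ ⟨
    (S A B ∣ 1ʰ C) ÷ ⌜ coe p ⌝ ÷ (1ʰ B ∣ S A C)
      ≋⟨ ÷-cong (≋-trans (∣-cong ≋-refl (≋-sym (⌜⌝-id C))) (⌜⌝-⊗ _ _))
         (÷-cong ≋-refl (≋-trans (∣-cong (≋-sym (⌜⌝-id B)) ≋-refl) (⌜⌝-⊗ _ _))) ⟩
    ⌜ σ A B ⊗₁ id ⌝ ÷ ⌜ coe p ⌝ ÷ ⌜ id ⊗₁ σ A C ⌝
      ≋⟨ ≋-trans (÷-cong ≋-refl (⌜⌝-⨾ _ _)) (⌜⌝-⨾ _ _) ⟩
    ⌜ (σ A B ⊗₁ id) ⨾ᴬ coe p ⨾ᴬ (id ⊗₁ σ A C) ⌝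
      ≋⟨ ⌜⌝-cong-≋ (σ-hexagon A B C) ⟩
    S A (B ⊗ C)
      ∎
    where
    p : (B ⊗ A) ⊗ C ≡ B ⊗ (A ⊗ C)
    p = ⊗-assoc B A C

  -- The left-hand side is inverse to S C (A ⊗ B), by the first hexagon.
  hexagon′ : ∀ A B C →
             (1ʰ A ∣ S B C) ÷[ sym (⊗-assoc A C B) ] (S A C ∣ 1ʰ B) ≋ S (A ⊗ B) C
  hexagon′ A B C = begin
    P                                      ≋⟨ ÷-identityʳ P ⟨
    P ÷ 1ʰ ((C ⊗ A) ⊗ B)                   ≋⟨ ÷[]-cong {p = refl} {p′ = r} ≋-refl
                                                (≋-trans (1ʰ-cong r) (≋-sym (S-involutive C (A ⊗ B)))) ⟩
    P ÷[ r ] (S C (A ⊗ B) ÷ S (A ⊗ B) C)   ≋⟨ ÷[]-cong {p = r} {p′ = refl} ≋-refl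
                                                (÷[]-cong {p = refl} {p′ = s} (≋-sym (hexagon C A B)) ≋-refl) ⟩
    P ÷ (Q ÷[ s ] S (A ⊗ B) C)             ≋⟨ ÷[]-assoc P refl Q s _ ⟨
    (P ÷ Q) ÷[ s ] S (A ⊗ B) C             ≋⟨ ÷[]-cong {p = s} {p′ = s} P÷Q ≋-refl ⟩
    1ʰ (A ⊗ (B ⊗ C)) ÷[ s ] S (A ⊗ B) C    ≋⟨ ÷[]-identityˡ s _ ⟩
    S (A ⊗ B) C                            ∎
    where
    p : A ⊗ (C ⊗ B) ≡ (A ⊗ C) ⊗ B
    p = sym (⊗-assoc A C B)
    q : (A ⊗ C) ⊗ B ≡ A ⊗ (C ⊗ B)
    q = ⊗-assoc A C B
    r : (C ⊗ A) ⊗ B ≡ C ⊗ (A ⊗ B)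
    r = ⊗-assoc C A B
    s : A ⊗ (B ⊗ C) ≡ (A ⊗ B) ⊗ C
    s = sym (⊗-assoc A B C)
    P : Cell (A ⊗ (B ⊗ C)) ((C ⊗ A) ⊗ B) [] []
    P = (1ʰ A ∣ S B C) ÷[ p ] (S A C ∣ 1ʰ B)
    Q : Cell ((C ⊗ A) ⊗ B) (A ⊗ (B ⊗ C)) [] []
    Q = (S C A ∣ 1ʰ B) ÷[ q ] (1ʰ A ∣ S C B)
    P÷Q : P ÷ Q ≋ 1ʰ (A ⊗ (B ⊗ C))
    P÷Q = begin
      P ÷ Q
        ≋⟨ ÷[]-assoc (1ʰ A ∣ S B C) p (S A C ∣ 1ʰ B) refl Q ⟩
      (1ʰ A ∣ S B C) ÷[ p ] ((S A C ∣ 1ʰ B) ÷ Q)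
        ≋⟨ ÷[]-cong {p = p} {p′ = p} ≋-refl
             (≋-sym (÷[]-assoc (S A C ∣ 1ʰ B) refl (S C A ∣ 1ʰ B) q _)) ⟩
      (1ʰ A ∣ S B C) ÷[ p ] (((S A C ∣ 1ʰ B) ÷ (S C A ∣ 1ʰ B)) ÷[ q ] (1ʰ A ∣ S C B))
        ≋⟨ ÷-identity-middle {B≡C = p} {C≡B = q} _ _ (S∣1ʰ-involutive A C B) ⟩
      (1ʰ A ∣ S B C) ÷ (1ʰ A ∣ S C B)
        ≋⟨ 1ʰ∣S-involutive A B C ⟩
      1ʰ (A ⊗ (B ⊗ C))
        ∎

  -- By the hexagon for A, I, I the cell S A I is idempotent; it is also invertible.
  S-unitʳ : ∀ A → S A I ≋ 1ʰ A
  S-unitʳ A = begin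
    S A I
      ≋⟨ ÷-identityʳ _ ⟨
    S A I ÷ 1ʰ (I ⊗ A)
      ≋⟨ ÷[]-cong {p = refl} {p′ = p} ≋-refl (≋-trans (1ʰ-cong p) (≋-sym (S-involutive A I))) ⟩
    S A I ÷[ p ] (S A I ÷ S I A)
      ≋⟨ ÷[]-assoc (S A I) p (S A I) refl (S I A) ⟨
    (S A I ÷[ p ] S A I) ÷ S I A
      ≋⟨ ÷-cong idempotent ≋-refl ⟩
    S A I ÷ S I A
      ≋⟨ S-involutive A I ⟩
    1ʰ (A ⊗ I)
      ≋⟨ 1ʰ-cong (⊗-identityʳ A) ⟩
    1ʰ A
      ∎
    where
    p : I ⊗ A ≡ A ⊗ I
    p = trans (⊗-identityˡ A) (sym (⊗-identityʳ A))
    idempotent : S A I ÷[ p ] S A I ≋ S A I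
    idempotent = begin
      S A I ÷[ p ] S A I
        ≋⟨ ÷[]-cong {p = ⊗-assoc I A I} {p′ = p} (1ʰ-∣-identityʳ (S A I)) (1ʰ-∣-identityˡ (S A I)) ⟨
      (S A I ∣ 1ʰ I) ÷[ ⊗-assoc I A I ] (1ʰ I ∣ S A I)
        ≋⟨ hexagon A I I ⟩
      S A (I ⊗ I)
        ≋⟨ S-cong refl (⊗-identityˡ I) ⟩
      S A I
        ∎

  -- `S I A` is inverse to `S A I`, which `S-unitʳ` identifies with an identity.
  S-unitˡ : ∀ A → S I A ≋ 1ʰ A
  S-unitˡ A = begin
    S I A                ≋⟨ ÷-identityˡ _ ⟨
    1ʰ (I ⊗ A) ÷ S I A   ≋⟨ ÷[]-cong {p = refl} {p′ = refl}
                              (≋-trans (1ʰ-cong (⊗-identityˡ A)) (≋-sym (S-unitʳ A))) ≋-refl ⟩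
    S A I ÷ S I A        ≋⟨ S-involutive A I ⟩
    1ʰ (A ⊗ I)           ≋⟨ 1ʰ-cong (⊗-identityʳ A) ⟩
    1ʰ A                 ∎

  -- A form of the Yang-Baxter equation: both sides reverse three factors. One hexagon expands
  -- `S (A ⊗ B) C`, the other contracts the result to `S A (C ⊗ B)`, and naturality moves `S B C`
  -- past it.
  S-reverse : ∀ A B C →
              S (A ⊗ B) C ÷ (1ʰ C ∣ S A B) ≋ S A (B ⊗ C) ÷ (S B C ∣ 1ʰ A)
  S-reverse A B C = begin
    S (A ⊗ B) C ÷ (1ʰ C ∣ S A B)
      ≋⟨ ÷[]-cong {p = q} {p′ = refl} (hexagon′ A B C) ≋-refl ⟨
    ((1ʰ A ∣ S B C) ÷[ p ] (S A C ∣ 1ʰ B)) ÷[ q ] (1ʰ C ∣ S A B)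
      ≋⟨ ÷[]-assoc (1ʰ A ∣ S B C) p (S A C ∣ 1ʰ B) q _ ⟩
    (1ʰ A ∣ S B C) ÷[ p ] ((S A C ∣ 1ʰ B) ÷[ q ] (1ʰ C ∣ S A B))
      ≋⟨ ÷[]-cong {p = p} {p′ = refl} ≋-refl (hexagon A C B) ⟩
    (1ʰ A ∣ S B C) ÷ S A (C ⊗ B)
      ≋⟨ S-naturalʳ A (σ B C) ⟩
    S A (B ⊗ C) ÷ (S B C ∣ 1ʰ A)
      ∎
    where
    p : A ⊗ (C ⊗ B) ≡ (A ⊗ C) ⊗ B
    p = sym (⊗-assoc A C B)
    q : (C ⊗ A) ⊗ B ≡ C ⊗ (A ⊗ B)
    q = ⊗-assoc C A B

  -- The counterpart of `S-reverse` for bottom boundaries, with the two hexagons in exchanged roles.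
  S-reverse′ : ∀ A B C →
               (1ʰ C ∣ S B A) ÷ S C (A ⊗ B) ≋ (S C B ∣ 1ʰ A) ÷ S (B ⊗ C) A
  S-reverse′ A B C = begin
    (1ʰ C ∣ S B A) ÷ S C (A ⊗ B)
      ≋⟨ ÷[]-cong {p = p} {p′ = refl} ≋-refl (hexagon C A B) ⟨
    (1ʰ C ∣ S B A) ÷[ p ] ((S C A ∣ 1ʰ B) ÷[ q ] (1ʰ A ∣ S C B))
      ≋⟨ ÷[]-assoc (1ʰ C ∣ S B A) p (S C A ∣ 1ʰ B) q _ ⟨
    ((1ʰ C ∣ S B A) ÷[ p ] (S C A ∣ 1ʰ B)) ÷[ q ] (1ʰ A ∣ S C B)
      ≋⟨ ÷[]-cong {p = q} {p′ = refl} (hexagon′ C B A) ≋-refl ⟩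
    S (C ⊗ B) A ÷ (1ʰ A ∣ S C B)
      ≋⟨ S-naturalˡ A (σ C B) ⟨
    (S C B ∣ 1ʰ A) ÷ S (B ⊗ C) A
      ∎
    where
    p : C ⊗ (A ⊗ B) ≡ (C ⊗ A) ⊗ B
    p = sym (⊗-assoc C A B)
    q : (A ⊗ C) ⊗ B ≡ A ⊗ (C ⊗ B)
    q = ⊗-assoc A C B

  -- Reversed horizontal composition and its laws.

  infixr 6 _∣ˢ_

  -- Stacking the lower symmetry leaves a trailing `[]` on the side boundaries. The cast removes it,
  -- so that the type is exactly the one `reflect` needs.
  _∣ˢ_ : Cell A B Y Z → Cell A′ B′ X Y → Cell (A ⊗ A′) (B ⊗ B′) X Z
  _∣ˢ_ {A} {B} {A′ = A′} {B′ = B′} α β =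
    castᵛ (++-identityʳ _) (++-identityʳ _) ((S A A′ ÷ (β ∣ α)) ÷ S B′ B)

  ∣ˢ-unfold : (α : Cell A B Y Z) (β : Cell A′ B′ X Y) →
              α ∣ˢ β ≋ (S A A′ ÷ (β ∣ α)) ÷ S B′ B
  ∣ˢ-unfold α β = castᵛ-≋ _ _ _

  ∣ˢ-cong : {α : Cell A B Y Z} {β : Cell C D X Y}
            {α′ : Cell A′ B′ Y′ Z′} {β′ : Cell C′ D′ X′ Y′} →
            α ≋ α′ → β ≋ β′ → α ∣ˢ β ≋ α′ ∣ˢ β′
  ∣ˢ-cong p q =
    -- The symmetries are indexed by the top and bottom edges, so equalities of these edges must be
    -- recovered from `p` and `q`.
    let a , b , _ = boundary p
        c , d , _ = boundary q
    in  ≋-trans (∣ˢ-unfold _ _)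
        (≋-trans (÷-cong (÷-cong (S-cong a c) (∣-cong q p)) (S-cong d b))
                 (≋-sym (∣ˢ-unfold _ _)))

  -- Padding `γ` with identities above and below gives it the three layers of `α ∣ˢ β`; two
  -- interchanges then compose layer by layer.
  ∣ˢ-∣-1ʰ : (α : Cell A B Y Z) (β : Cell A′ B′ X Y) (γ : Cell C D Z W) →
            (α ∣ˢ β) ∣ γ ≋ ((S A A′ ∣ 1ʰ C) ÷ ((β ∣ α) ∣ γ)) ÷ (S B′ B ∣ 1ʰ D)
  ∣ˢ-∣-1ʰ {A} {B} {A′ = A′} {B′} {C = C} {D} α β γ = begin
    (α ∣ˢ β) ∣ γ
      ≋⟨ ∣-cong (∣ˢ-unfold α β) (≋-sym (÷-unitor γ)) ⟩
    ((S A A′ ÷ (β ∣ α)) ÷ S B′ B) ∣ ((1ʰ C ÷ γ) ÷ 1ʰ D)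
      ≋⟨ interchange _ _ _ _ ⟩
    ((S A A′ ÷ (β ∣ α)) ∣ (1ʰ C ÷ γ)) ÷ (S B′ B ∣ 1ʰ D)
      ≋⟨ ÷-cong (interchange _ _ _ _) ≋-refl ⟩
    ((S A A′ ∣ 1ʰ C) ÷ ((β ∣ α) ∣ γ)) ÷ (S B′ B ∣ 1ʰ D)
      ∎

  1ʰ-∣-∣ˢ : (γ : Cell C D X Y) (α : Cell A B Z W) (β : Cell A′ B′ Y Z) →
            γ ∣ (α ∣ˢ β) ≋ ((1ʰ C ∣ S A A′) ÷ (γ ∣ (β ∣ α))) ÷ (1ʰ D ∣ S B′ B)
  1ʰ-∣-∣ˢ {C} {D} {A = A} {B} {A′ = A′} {B′} γ α β = begin
    γ ∣ (α ∣ˢ β)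
      ≋⟨ ∣-cong (≋-sym (÷-unitor γ)) (∣ˢ-unfold α β) ⟩
    ((1ʰ C ÷ γ) ÷ 1ʰ D) ∣ ((S A A′ ÷ (β ∣ α)) ÷ S B′ B)
      ≋⟨ interchange _ _ _ _ ⟩
    ((1ʰ C ÷ γ) ∣ (S A A′ ÷ (β ∣ α))) ÷ (1ʰ D ∣ S B′ B)
      ≋⟨ ÷-cong (interchange _ _ _ _) ≋-refl ⟩
    ((1ʰ C ∣ S A A′) ÷ (γ ∣ (β ∣ α))) ÷ (1ʰ D ∣ S B′ B)
      ∎

  -- Both sides become a composite of `γ`, `β`, `α` between two reversals of three factors.
  -- `S-reverse` matches the upper reversals, `S-reverse′` the lower ones, and `∣-assoc` the cores.
  ∣ˢ-assoc : (α : Cell A B Z W) (β : Cell A′ B′ Y Z) (γ : Cell A″ B″ X Y) →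
             (α ∣ˢ β) ∣ˢ γ ≋ α ∣ˢ (β ∣ˢ γ)
  ∣ˢ-assoc {A} {B} {A′ = A′} {B′} {A″ = A″} {B″} α β γ = begin
    (α ∣ˢ β) ∣ˢ γ
      ≋⟨ ∣ˢ-unfold _ _ ⟩
    (S (A ⊗ A′) A″ ÷ (γ ∣ (α ∣ˢ β))) ÷ S B″ (B ⊗ B′)
      ≋⟨ ÷-cong (÷-cong ≋-refl (1ʰ-∣-∣ˢ γ α β)) ≋-refl ⟩
    (S (A ⊗ A′) A″ ÷ (((1ʰ A″ ∣ S A A′) ÷ (γ ∣ (β ∣ α))) ÷ (1ʰ B″ ∣ S B′ B))) ÷ S B″ (B ⊗ B′)
      ≋⟨ ÷-regroup _ _ _ _ _ ⟩
    ((S (A ⊗ A′) A″ ÷ (1ʰ A″ ∣ S A A′)) ÷ (γ ∣ (β ∣ α))) ÷ ((1ʰ B″ ∣ S B′ B) ÷ S B″ (B ⊗ B′))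
      ≋⟨ ÷-cong (÷-cong (S-reverse A A′ A″) (≋-sym (∣-assoc γ β α))) (S-reverse′ B B′ B″) ⟩
    ((S A (A′ ⊗ A″) ÷ (S A′ A″ ∣ 1ʰ A)) ÷ ((γ ∣ β) ∣ α)) ÷ ((S B″ B′ ∣ 1ʰ B) ÷ S (B′ ⊗ B″) B)
      ≋⟨ ÷-regroup _ _ _ _ _ ⟨
    (S A (A′ ⊗ A″) ÷ (((S A′ A″ ∣ 1ʰ A) ÷ ((γ ∣ β) ∣ α)) ÷ (S B″ B′ ∣ 1ʰ B))) ÷ S (B′ ⊗ B″) B
      ≋⟨ ÷-cong (÷-cong ≋-refl (∣ˢ-∣-1ʰ β γ α)) ≋-refl ⟨
    (S A (A′ ⊗ A″) ÷ ((β ∣ˢ γ) ∣ α)) ÷ S (B′ ⊗ B″) B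
      ≋⟨ ∣ˢ-unfold _ _ ⟨
    α ∣ˢ (β ∣ˢ γ)
      ∎

  -- Removes trivial symmetries around a core. The identities may sit on differently written edges,
  -- as in `S-unitʳ`; `boundary` aligns them with the edges of `α`.
  ÷-identities : {ε : Cell A B [] []} {α : Cell B C X Y} {η : Cell C D [] []} →
                 ε ≋ 1ʰ A′ → η ≋ 1ʰ B′ → (ε ÷ α) ÷ η ≋ α
  ÷-identities p q =
    let _ , b , _ = boundary p
        c , _     = boundary q
    in  ≋-trans (÷-cong (÷-cong (≋-trans p (1ʰ-cong (sym b))) ≋-refl)
                        (≋-trans q (1ʰ-cong (sym c))))
                (÷-unitor _)

  ∣ˢ-identityˡ : (α : Cell A B X Y) → 1ᵛ Y ∣ˢ α ≋ α
  ∣ˢ-identityˡ {A} {B} α =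
    ≋-trans (∣ˢ-unfold _ _)
    (≋-trans (÷-identities (S-unitˡ A) (S-unitʳ B)) (∣-identityʳ α))

  ∣ˢ-identityʳ : (α : Cell A B X Y) → α ∣ˢ 1ᵛ X ≋ α
  ∣ˢ-identityʳ {A} {B} α =
    ≋-trans (∣ˢ-unfold _ _)
    (≋-trans (÷-identities (S-unitʳ A) (S-unitˡ B)) (∣-identityˡ α))

  ∣ˢ-interchange : (α : Cell A B Y Z) (β : Cell B C Y′ Z′)
                   (γ : Cell A′ B′ X Y) (δ : Cell B′ C′ X′ Y′) →
                   (α ÷ β) ∣ˢ (γ ÷ δ) ≋ (α ∣ˢ γ) ÷ (β ∣ˢ δ)
  ∣ˢ-interchange {A} {B} {C = C} {A′ = A′} {B′} {C′ = C′} α β γ δ = begin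
    (α ÷ β) ∣ˢ (γ ÷ δ)
      ≋⟨ ∣ˢ-unfold _ _ ⟩
    (S A A′ ÷ ((γ ÷ δ) ∣ (α ÷ β))) ÷ S C′ C
      ≋⟨ ÷-cong (÷-cong ≋-refl (interchange γ δ α β)) ≋-refl ⟩
    (S A A′ ÷ ((γ ∣ α) ÷ (δ ∣ β))) ÷ S C′ C
      ≋⟨ ÷-cong (÷-assoc _ _ _) ≋-refl ⟨
    ((S A A′ ÷ (γ ∣ α)) ÷ (δ ∣ β)) ÷ S C′ C
      ≋⟨ ÷-assoc _ _ _ ⟩
    (S A A′ ÷ (γ ∣ α)) ÷ ((δ ∣ β) ÷ S C′ C)
      -- Of the inserted inverse pair, `S B′ B` becomes the bottom of `α ∣ˢ γ` and `S B B′` the top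
      -- of `β ∣ˢ δ`.
      ≋⟨ ÷-identity-middle {B≡C = refl} {C≡B = refl} _ _ (S-involutive B′ B) ⟨
    (S A A′ ÷ (γ ∣ α)) ÷ ((S B′ B ÷ S B B′) ÷ ((δ ∣ β) ÷ S C′ C))
      ≋⟨ ÷-cong ≋-refl (÷-assoc _ _ _) ⟩
    (S A A′ ÷ (γ ∣ α)) ÷ (S B′ B ÷ (S B B′ ÷ ((δ ∣ β) ÷ S C′ C)))
      ≋⟨ ÷-assoc _ _ _ ⟨
    ((S A A′ ÷ (γ ∣ α)) ÷ S B′ B) ÷ (S B B′ ÷ ((δ ∣ β) ÷ S C′ C))
      ≋⟨ ÷-cong (∣ˢ-unfold α γ) (≋-trans (∣ˢ-unfold β δ) (÷-assoc _ _ _)) ⟨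
    (α ∣ˢ γ) ÷ (β ∣ˢ δ)
      ∎

  -- Naturality of `σ` undoes the reversal, after which the two symmetries meet and cancel.
  ∣ˢ-⌜⌝ : (f : Hom A B) (g : Hom C D) → ⌜ f ⌝ ∣ˢ ⌜ g ⌝ ≋ ⌜ f ⊗₁ g ⌝
  ∣ˢ-⌜⌝ {A} {B} {C} {D} f g = begin
    ⌜ f ⌝ ∣ˢ ⌜ g ⌝                        ≋⟨ ∣ˢ-unfold _ _ ⟩
    (S A C ÷ (⌜ g ⌝ ∣ ⌜ f ⌝)) ÷ S D B     ≋⟨ ÷-cong (S-natural f g) ≋-refl ⟨
    ((⌜ f ⌝ ∣ ⌜ g ⌝) ÷ S B D) ÷ S D B     ≋⟨ ÷-assoc _ _ _ ⟩
    (⌜ f ⌝ ∣ ⌜ g ⌝) ÷ (S B D ÷ S D B)     ≋⟨ ÷-cong ≋-refl (S-involutive B D) ⟩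
    (⌜ f ⌝ ∣ ⌜ g ⌝) ÷ 1ʰ (B ⊗ D)          ≋⟨ ÷-identityʳ _ ⟩
    ⌜ f ⌝ ∣ ⌜ g ⌝                         ≋⟨ ⌜⌝-⊗ f g ⟩
    ⌜ f ⊗₁ g ⌝                            ∎

  ∣ˢ-1ʰ : ∀ A B → 1ʰ A ∣ˢ 1ʰ B ≋ 1ʰ (A ⊗ B)
  ∣ˢ-1ʰ A B = begin
    1ʰ A ∣ˢ 1ʰ B                   ≋⟨ ∣ˢ-unfold _ _ ⟩
    (S A B ÷ (1ʰ B ∣ 1ʰ A)) ÷ S B A   ≋⟨ ÷-cong (÷-cong ≋-refl (1ʰ-∣ B A)) ≋-refl ⟩
    (S A B ÷ 1ʰ (B ⊗ A)) ÷ S B A   ≋⟨ ÷-cong (÷-identityʳ _) ≋-refl ⟩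
    S A B ÷ S B A                  ≋⟨ S-involutive A B ⟩
    1ʰ (A ⊗ B)                     ∎

  -- Duality of vertical edges and reflection of cells.

  dual : Edge → Edge
  dual = map (map₂ flip)

  -- The factors keep their order because reflection in a vertical axis leaves the vertical order
  -- unchanged.
  dual-++ : ∀ X Y → dual (X ++ Y) ≡ dual X ++ dual Y
  dual-++ = map-++ (map₂ flip)

  dual-involutive : ∀ X → dual (dual X) ≡ X
  dual-involutive X = trans (sym (map-∘ X))
    (trans (map-cong (λ (A , p) → cong (A ,_) (flip-involutive p)) X) (map-id X))

  -- Defined by recursion on cell terms; `reflect-cong` makes it well defined on the free cornering.
  -- The cast for `÷` is there because `dual-++` holds only propositionally.
  reflect : Cell A B X Y → Cell A B (dual Y) (dual X)
  reflect (s° A)  = s• A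
  reflect (r° A)  = r• A
  reflect (s• A)  = s° A
  reflect (r• A)  = r° A
  reflect ⌜ f ⌝   = ⌜ f ⌝
  reflect (1ʰ A)  = 1ʰ A
  reflect (1ᵛ X)  = 1ᵛ (dual X)
  reflect (α ∣ β) = reflect α ∣ˢ reflect β
  reflect (_÷_ {X = X} {Y = Y} α β) =
    castᵛ (sym (dual-++ Y _)) (sym (dual-++ X _)) (reflect α ÷ reflect β)

  reflect-÷ : (α : Cell A B X Y) (β : Cell B C X′ Y′) →
              reflect (α ÷ β) ≋ reflect α ÷ reflect β
  reflect-÷ α β = castᵛ-≋ _ _ _

  -- Induction on derivations: laws of `∣` become the corresponding laws of `∣ˢ`, while laws of `÷`
  -- are reused once the casts are stripped.
  reflect-cong : {α : Cell A B X Y} {β : Cell A′ B′ X′ Y′} →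
                 α ≋ β → reflect α ≋ reflect β
  reflect-cong ≋-refl        = ≋-refl
  reflect-cong (≋-sym p)     = ≋-sym (reflect-cong p)
  reflect-cong (≋-trans p q) = ≋-trans (reflect-cong p) (reflect-cong q)
  reflect-cong (∣-cong p q)  = ∣ˢ-cong (reflect-cong p) (reflect-cong q)
  reflect-cong (÷-cong {α = α} {β} {α′} {β′} p q) =
    ≋-trans (reflect-÷ α β)
    (≋-trans (÷-cong (reflect-cong p) (reflect-cong q)) (≋-sym (reflect-÷ α′ β′)))
  reflect-cong (⌜⌝-cong p)     = ⌜⌝-cong p
  reflect-cong (∣-assoc α β γ) = ∣ˢ-assoc (reflect α) (reflect β) (reflect γ)
  reflect-cong (÷-assoc α β γ) = begin
    reflect ((α ÷ β) ÷ γ)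
      ≋⟨ ≋-trans (reflect-÷ (α ÷ β) γ) (÷-cong (reflect-÷ α β) ≋-refl) ⟩
    (reflect α ÷ reflect β) ÷ reflect γ
      ≋⟨ ÷-assoc _ _ _ ⟩
    reflect α ÷ (reflect β ÷ reflect γ)
      ≋⟨ ≋-trans (reflect-÷ α (β ÷ γ)) (÷-cong ≋-refl (reflect-÷ β γ)) ⟨
    reflect (α ÷ (β ÷ γ))
      ∎
  reflect-cong (∣-identityˡ α) = ∣ˢ-identityˡ (reflect α)
  reflect-cong (∣-identityʳ α) = ∣ˢ-identityʳ (reflect α)
  reflect-cong (÷-identityˡ α) = ≋-trans (reflect-÷ (1ʰ _) α) (÷-identityˡ _)
  reflect-cong (÷-identityʳ α) = ≋-trans (reflect-÷ α (1ʰ _)) (÷-identityʳ _)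
  reflect-cong (1ʰ-∣ A B)      = ∣ˢ-1ʰ A B
  reflect-cong (1ᵛ-÷ X Y)      =
    ≋-trans (reflect-÷ (1ᵛ X) (1ᵛ Y))
    (≋-trans (1ᵛ-÷ _ _) (1ᵛ-cong (sym (dual-++ X Y))))
  reflect-cong 1ʰ≋1ᵛ = 1ʰ≋1ᵛ
  reflect-cong (interchange α β γ δ) = begin
    reflect (α ÷ β) ∣ˢ reflect (γ ÷ δ)
      ≋⟨ ∣ˢ-cong (reflect-÷ α β) (reflect-÷ γ δ) ⟩
    (reflect α ÷ reflect β) ∣ˢ (reflect γ ÷ reflect δ)
      ≋⟨ ∣ˢ-interchange _ _ _ _ ⟩
    reflect (α ∣ γ) ÷ reflect (β ∣ δ)
      ≋⟨ reflect-÷ (α ∣ γ) (β ∣ δ) ⟨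
    reflect ((α ∣ γ) ÷ (β ∣ δ))
      ∎
  -- Each corner has `I` as its top or bottom, so both surrounding symmetries are `S A I`, hence
  -- trivial.
  reflect-cong (yank-∣° A) =
    ≋-trans (∣ˢ-unfold (s• A) (r• A))
    (≋-trans (÷-identities (S-unitʳ A) (S-unitʳ A)) (yank-∣• A))
  -- On these concrete edges `dual-++` computes to `refl`, so the cast in `reflect` disappears.
  reflect-cong (yank-÷° A) = yank-÷• A
  reflect-cong (yank-∣• A) =
    ≋-trans (∣ˢ-unfold (r° A) (s° A))
    (≋-trans (÷-identities (S-unitˡ A) (S-unitˡ A)) (yank-∣° A))
  reflect-cong (yank-÷• A) = yank-÷° A
  reflect-cong (⌜⌝-⨾ f g)  = ⌜⌝-⨾ f g
  reflect-cong (⌜⌝-id A)   = ⌜⌝-id A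
  reflect-cong (⌜⌝-⊗ f g)  = ∣ˢ-⌜⌝ f g

  -- Reflection reverses the core a second time, which surrounds it with a second layer of
  -- symmetries; these cancel the first layer above and below.
  reflect-∣ˢ : (α : Cell A B Y Z) (β : Cell A′ B′ X Y) →
               reflect (α ∣ˢ β) ≋ reflect α ∣ reflect β
  reflect-∣ˢ {A} {B} {A′ = A′} {B′} α β = begin
    reflect (α ∣ˢ β)
      ≋⟨ reflect-cong (∣ˢ-unfold α β) ⟩
    reflect ((S A A′ ÷ (β ∣ α)) ÷ S B′ B)
      ≋⟨ ≋-trans (reflect-÷ (S A A′ ÷ (β ∣ α)) (S B′ B))
                 (÷-cong (reflect-÷ (S A A′) (β ∣ α)) ≋-refl) ⟩
    (S A A′ ÷ (reflect β ∣ˢ reflect α)) ÷ S B′ B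
      ≋⟨ ÷-cong (÷-cong ≋-refl (∣ˢ-unfold _ _)) ≋-refl ⟩
    (S A A′ ÷ ((S A′ A ÷ (reflect α ∣ reflect β)) ÷ S B B′)) ÷ S B′ B
      ≋⟨ ÷-regroup _ _ _ _ _ ⟩
    ((S A A′ ÷ S A′ A) ÷ (reflect α ∣ reflect β)) ÷ (S B B′ ÷ S B′ B)
      ≋⟨ ÷-identities (S-involutive A A′) (S-involutive B B′) ⟩
    reflect α ∣ reflect β
      ∎

  reflect-involutive : (α : Cell A B X Y) → reflect (reflect α) ≋ α
  reflect-involutive (s° A)  = ≋-refl
  reflect-involutive (r° A)  = ≋-refl
  reflect-involutive (s• A)  = ≋-refl
  reflect-involutive (r• A)  = ≋-refl
  reflect-involutive ⌜ f ⌝   = ≋-refl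
  reflect-involutive (1ʰ A)  = ≋-refl
  reflect-involutive (1ᵛ X)  = 1ᵛ-cong (dual-involutive X)
  reflect-involutive (α ∣ β) =
    ≋-trans (reflect-∣ˢ (reflect α) (reflect β))
            (∣-cong (reflect-involutive α) (reflect-involutive β))
  reflect-involutive (α ÷ β) =
    -- The inner reflection is a cast; it has to be stripped under the outer `reflect` before that
    -- one can act on `÷`.
    ≋-trans (reflect-cong (reflect-÷ α β))
    (≋-trans (reflect-÷ (reflect α) (reflect β))
             (÷-cong (reflect-involutive α) (reflect-involutive β)))

  -- The involution on horizontal cells.

  open StrictMonoidalCategory (𝐇 (𝒞 𝔸)) using (category) renaming (_⨾_ to _⨾ᴴ_)

  ⨾ᴴ-≋-∣ : (α : Cell I I X Y) (β : Cell I I Y Z) → α ⨾ᴴ β ≋ α ∣ β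
  -- `_⨾ᴴ_` transports along `⊗-identityˡ I`. Abstracting the edge, the equality and the composite
  -- together lets the equality be matched with `refl`, and the transport computes away.
  ⨾ᴴ-≋-∣ α β with I ⊗ I | ⊗-identityˡ I | α ∣ β
  ... | _ | refl | _ = ≋-refl

  reflect-⨾ᴴ : (α : Cell I I X Y) (β : Cell I I Y Z) →
               reflect (α ⨾ᴴ β) ≋ reflect β ⨾ᴴ reflect α
  reflect-⨾ᴴ α β = begin
    reflect (α ⨾ᴴ β)
      ≋⟨ reflect-cong (⨾ᴴ-≋-∣ α β) ⟩
    reflect α ∣ˢ reflect β
      ≋⟨ ∣ˢ-unfold _ _ ⟩
    (S I I ÷ (reflect β ∣ reflect α)) ÷ S I I
      ≋⟨ ÷-identities (S-unitˡ I) (S-unitˡ I) ⟩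
    reflect β ∣ reflect α
      ≋⟨ ⨾ᴴ-≋-∣ _ _ ⟨
    reflect β ⨾ᴴ reflect α
      ∎

  reflection : ContravariantInvolution category
  reflection = record
    { functor = record
      { F₀       = dual
      ; F₁       = reflect
      ; F-cong   = reflect-cong
      ; identity = ≋-refl
      -- The arguments swap because composition in the domain is that of the opposite category.
      ; homo     = λ α β → reflect-⨾ᴴ β α
      }
    ; involutive₀ = dual-involutive
    ; involutive₁ = λ α → ≋⇒Het (reflect-involutive α)
    }

lemma6p6 : ∀ {o ℓ e} (𝔸 : SymmetricStrictMonoidalCategory o ℓ e) →
    let open StrictMonoidalCategory (𝐇 (𝒞 𝔸))
    in
    Σ[ inv ∈ ContravariantInvolution category ]
    let open ContravariantInvolution inv in
    (I *₀ ≡ I)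
    × (∀ (A : SymmetricStrictMonoidalCategory.Obj 𝔸) → (A °) *₀ ≡ A •)
    × (∀ (A : SymmetricStrictMonoidalCategory.Obj 𝔸) → (A •) *₀ ≡ A °)
    × (∀ X Y → (X ⊗ Y) *₀ ≡ (X *₀) ⊗ (Y *₀))
    × (∀ {X Y Z W} (f : Hom X Y) (g : Hom Z W) → (f ⊗₁ g) *₁ ≋ (f *₁) ⊗₁ (g *₁))
lemma6p6 𝔸 =
  reflection , refl , (λ _ → refl) , (λ _ → refl) , dual-++ , λ f g → ≋⇒Het (reflect-÷ f g)
  where open Reflection 𝔸
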